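{- For every reverse semistandard Young tableau $V$, the right row-filling algorithm $\psi(V)$ is a well-defined element of $\mathrm{qKT}^{(1)}$, and $\psi:\mathrm{revSSYT}\to\mathrm{qKT}^{(1)}$ is a bijection with inverse $\phi$. Both maps preserve column sets.
   Context: $\mathrm{revSSYT}$ is the set of reverse semistandard Young tableaux of all partition shapes (English notation; positive integer entries; rows weakly decreasing left to right, columns strictly decreasing top to bottom). The $c$th column set of a tableau or filling is the set of entries in its $c$th column. For a weak composition $a$, $D(a)$ has $a_i$ left-justified boxes in row $i$, row 1 lowest. A quasi-key tableau of shape $a$ is a filling of $D(a)$ with positive integers such that (1) entries weakly decrease along rows and no entry of row $i$ exceeds $i$; (2) entries in each column are distinct and increase going up the first column; (3) if an entry $i$ is above an entry $k$ in the same column with $i<k$, there is an entry $j$ immediately right of $k$ with $i<j$; (4) for two rows with the higher row strictly longer, if $i$ is in column $c$ of the lower row and $j$ in column $c+1$ of the higher row, then $i<j$. $\mathrm{qKT}^{(1)}$ is the set of all quasi-key tableaux (of all shapes $a$) whose first-column entries equal their row indices. $\phi(T)$ for $T\in\mathrm{qKT}^{(1)}$: the top-justified tableau whose $c$th column consists of the entries of column $c$ of $T$ sorted decreasingly from top to bottom. Right row-filling $\psi(V)$: let $C_1,C_2,\ldots$ be the column sets of $V$. Repeat until all are empty: let $k$ be the largest index with $C_k$ nonempty; choose the smallest element $y_k$ of $C_k$; for $c=k-1,\ldots,1$ choose the smallest element $y_c$ of $C_c$ with $y_c\ge y_{c+1}$; make $(y_1,\ldots,y_k)$ (left to right) the row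 of index $y_1$ of the output filling; delete $y_1,\ldots,y_k$ from their column sets. The output is a filling of a skyline diagram. -}

module Defs where

open import Data.List.Base
  using (List; []; _∷_; map; filter; drop; head; last; length; mapMaybe; upTo; fromMaybe)
open import Data.List.Extrema.Nat using (min; max)
open import Data.List.Relation.Unary.All using (All)
open import Data.List.Relation.Unary.Linked using (Linked)
open import Data.List.Sort using (sort)
open import Data.Maybe.Base as Maybe using (Maybe; just; nothing; _>>=_)
open import Data.Nat.Base using (ℕ; zero; suc; _≤_; _<_; _≥_)
open import Data.Nat.ListAction using (sum)
open import Data.Nat.Properties using (_≟_; _≤?_; ≤-decTotalOrder)
open import Data.Product.Base using (_×_; ∃-syntax)
open import Level using (0ℓ)
open import Relation.Binary.Bundles using (Setoid)
import Relation.Binary.Construct.Flip.EqAndOrd as Flip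
import Relation.Binary.Construct.On as On
open import Relation.Binary.PropositionalEquality
  using (_≡_; _≢_; setoid)
open import Relation.Nullary.Decidable using (¬?)

-- A left-justified filling, given by its list of rows.  Rows and columns
-- are counted from 0.  A tableau of partition shape lists its rows from
-- top to bottom.  A filling of a skyline diagram lists them from bottom to
-- top, so that position r holds the row of index suc r, and a larger
-- position is higher in the diagram.
Filling : Set
Filling = List (List ℕ)

infixl 8 _!?_
_!?_ : {A : Set} → List A → ℕ → Maybe A
xs !? n = head (drop n xs)

infix 4 _[_,_]=_
_[_,_]=_ : Filling → ℕ → ℕ → ℕ → Set
T [ r , c ]= x = (T !? r >>= λ row → row !? c) ≡ just x

shape : Filling → List ℕ
shape = map length

column : ℕ → Filling → List ℕ
column c = mapMaybe (_!? c)

columns : Filling → List (List ℕ)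
columns T = map (λ c → column c T) (upTo (max 0 (shape T)))

IsPartition : List ℕ → Set
IsPartition p = All (0 <_) p × Linked _≥_ p

record IsRevSSYT (p : List ℕ) (V : Filling) : Set where
  field
    hasShape        : shape V ≡ p
    positive        : All (All (0 <_)) V
    rowsDecrease    : All (Linked _≥_) V
    columnsDecrease : ∀ {r s c x y} → r < s →
                      V [ r , c ]= x → V [ s , c ]= y → y < x

record RevSSYT : Set where
  field
    tableau   : Filling
    partition : ∃[ p ] IsPartition p × IsRevSSYT p tableau

-- Only the filling matters for equality, not the proofs about it.
revSSYT : Setoid 0ℓ 0ℓ
revSSYT = On.setoid (setoid Filling) RevSSYT.tableau

-- Weak compositions differing only by trailing zeros have the same diagram
-- and the same fillings; they are represented by the one which does not
-- end in zero.
IsWeakComposition : List ℕ → Set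
IsWeakComposition a = last a ≢ just 0

record IsQuasiKey (a : List ℕ) (T : Filling) : Set where
  field
    hasShape       : shape T ≡ a
    positive       : All (All (0 <_)) T
    rowsDecrease   : All (Linked _≥_) T
    rowBound       : ∀ {r c x} → T [ r , c ]= x → x ≤ suc r
    columnDistinct : ∀ {r s c x y} → r ≢ s →
                     T [ r , c ]= x → T [ s , c ]= y → x ≢ y
    firstIncreases : ∀ {r s x y} → r < s →
                     T [ r , 0 ]= x → T [ s , 0 ]= y → x < y
    inversion      : ∀ {r s c i k} → r < s →
                     T [ s , c ]= i → T [ r , c ]= k → i < k →
                     ∃[ j ] T [ r , suc c ]= j × i < j
    longerAbove    : ∀ {r s R S c i j} → r < s →
                     T !? r ≡ just R → T !? s ≡ just S → length R < length S →
                     T [ r , c ]= i → T [ s , suc c ]= j → i < j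

record QKT¹ : Set where
  field
    filling     : Filling
    quasiKey    : ∃[ a ] IsWeakComposition a × IsQuasiKey a filling
    firstColumn : ∀ {r x} → filling [ r , 0 ]= x → x ≡ suc r

qKT¹ : Setoid 0ℓ 0ℓ
qKT¹ = On.setoid (setoid Filling) QKT¹.filling

sortDecreasing : List ℕ → List ℕ
sortDecreasing = sort (Flip.decTotalOrder ≤-decTotalOrder)

-- The outer  columns  transposes: reading the r-th entries of the sorted
-- columns from left to right gives row r of the top-justified tableau.
φ : Filling → Filling
φ T = columns (map sortDecreasing (columns T))

smallest : List ℕ → Maybe ℕ
smallest []       = nothing
smallest (x ∷ xs) = just (min x xs)

-- Prepends the choice made in column C to the choices y , ys made in the
-- columns to its right.  If there are none, all those columns are empty, and
-- C is the last nonempty column unless it is empty too.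
extend : List ℕ → List ℕ → Maybe (List ℕ)
extend C []       = just (fromMaybe (smallest C))
extend C (y ∷ ys) = Maybe.map (_∷ y ∷ ys) (smallest (filter (y ≤?_) C))

-- just []  is returned exactly when all columns are empty.
chooseRow : List (List ℕ) → Maybe (List ℕ)
chooseRow []       = just []
chooseRow (C ∷ Cs) = chooseRow Cs >>= extend C

delete : List ℕ → List (List ℕ) → List (List ℕ)
delete (y ∷ ys) (C ∷ Cs) = filter (λ x → ¬? (x ≟ y)) C ∷ delete ys Cs
delete _        Cs       = Cs

place : ℕ → List ℕ → Filling → Maybe Filling
place zero          ys T              = nothing
place (suc zero)    ys []             = just (ys ∷ [])
place (suc zero)    ys ([] ∷ T)       = just (ys ∷ T)
place (suc zero)    ys ((_ ∷ _) ∷ T)  = nothing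
place (suc (suc i)) ys []             = Maybe.map ([] ∷_) (place (suc i) ys [])
place (suc (suc i)) ys (R ∷ T)        = Maybe.map (R ∷_) (place (suc i) ys T)

-- The first argument bounds the number of rounds, the last one holds the
-- rows produced so far.
fillRows : ℕ → List (List ℕ) → Filling → Maybe Filling
continue : ℕ → List (List ℕ) → Filling → List ℕ → Maybe Filling

fillRows zero    Cs T = nothing
fillRows (suc n) Cs T = chooseRow Cs >>= continue n Cs T

continue n Cs T []           = just T
continue n Cs T ys@(y₁ ∷ _) = place y₁ ys T >>= fillRows n (delete ys Cs)

-- Right row-filling.  The result  nothing  means that the algorithm breaks
-- down: a required choice does not exist, the index of the new row is 0 or
-- already taken, or the columns are not exhausted in time.
-- Each round removes an entry from a column set, so there are at most as
-- many rounds as boxes, followed by the one which finds all columns empty.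
ψ : Filling → Maybe Filling
ψ V = fillRows (suc (sum (shape V))) (columns V) []

{-# OPTIONS --safe #-}
module Submission where

-- Say that a row R precedes a row S if, in every column, the row-filling
-- algorithm would prefer the entry of R to that of S.  A list of rows each of
-- which precedes all later ones is exactly what the algorithm produces from
-- the column sets of these rows.
--
-- The algorithm succeeds on the columns of a reverse semistandard tableau,
-- because each column dominates the next one (for every x it has at least as
-- many entries ≥ x) and this survives the deletion of the chosen row.  If R
-- and S are rows of the output, then one of them precedes the other, and this
-- gives the conditions on quasi-key tableaux for this pair.  Conversely, the conditions
-- imply that the rows of a tableau in qKT¹, listed by decreasing length and
-- from bottom to top among those of equal length, form such a list, so the
-- algorithm recovers it from its column sets.  A reverse semistandard tableau
-- is determined by its column sets as well, and φ preserves them.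

open import Defs
open import Data.Empty using (⊥-elim)
open import Data.List.Base
  using (List; []; _∷_; map; filter; last; length; applyUpTo; upTo; fromMaybe; concat; downFrom)
open import Data.List.Extrema.Nat using (min; max; min≤⊤; min≤xs; argmin-sel; max≤v⁺; xs≤max)
open import Data.List.Membership.Propositional using (_∈_)
open import Data.List.Membership.Propositional.Properties
  using (∈-filter⁺; ∈-filter⁻; ∈-concat⁺′; ∈-concat⁻′; ∈-map⁺; ∈-map⁻; ∈-downFrom⁺)
open import Data.List.Properties
  using (length-filter; filter-notAll; filter-some; filter-all; filter-accept; filter-none; map-∘; map-cong)
open import Data.List.Relation.Binary.BagAndSetEquality using (_∼[_]_; set)
open import Data.List.Relation.Binary.Permutation.Propositional using (_↭_; ↭⇒↭ₛ; ↭-sym)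
open import Data.List.Relation.Binary.Permutation.Propositional.Properties
  using (∈-resp-↭; ↭-length; filter-↭; ↭-empty-inv)
import Data.List.Relation.Binary.Permutation.Setoid.Properties as ↭ₛ
open import Data.List.Relation.Unary.All as All using (All; []; _∷_)
import Data.List.Relation.Unary.All.Properties as All
open import Data.List.Relation.Unary.AllPairs as AllPairs using (AllPairs; []; _∷_)
import Data.List.Relation.Unary.AllPairs.Properties as AllPairs
open import Data.List.Relation.Unary.Any as Any using (here; there)
open import Data.List.Relation.Unary.Linked as Linked using (Linked; []; [-]; _∷_)
import Data.List.Relation.Unary.Linked.Properties as Linked
open import Data.List.Relation.Unary.Unique.Propositional using (Unique)
import Data.List.Relation.Unary.Unique.Propositional.Properties as Unique
open import Data.List.Sort using (sort-↭; sort-↗)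
open import Data.Maybe.Base as Maybe using (Maybe; just; nothing; _>>=_)
open import Data.Maybe.Properties using (just-injective; ≡-dec)
open import Data.Nat.Base
open import Data.Nat.ListAction using (sum)
open import Data.Nat.Properties
open import Data.Product.Base using (Σ; ∃-syntax; _×_; _,_; proj₁; proj₂)
open import Data.Sum.Base using (_⊎_; inj₁; inj₂; [_,_]′)
open import Function.Base using (_∘_; id; flip; case_of_)
open import Function.Bundles using (_⇔_; mk⇔; Equivalence; Inverse)
open import Level using (0ℓ)
open import Relation.Binary.Core using (Rel)
open import Relation.Binary.Definitions using (tri<; tri≈; tri>)
import Relation.Binary.Construct.Flip.EqAndOrd as Flip
open import Relation.Binary.PropositionalEquality
open import Relation.Nullary using (¬_; yes; no; contradiction)
open import Relation.Nullary.Decidable using (¬?)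
open import Relation.Unary using (Decidable)

open Equivalence using (to; from)
open RevSSYT using (tableau)
open QKT¹ using (filling; firstColumn; quasiKey)

private variable
  A B : Set

-- Positions in lists

[]-!? : ∀ n → [] {A = A} !? n ≡ nothing
[]-!? zero    = refl
[]-!? (suc n) = refl

[]-!?-≢ : ∀ n {x : A} → [] !? n ≢ just x
[]-!?-≢ n eq with () ← trans (sym ([]-!? n)) eq

!?⇒∈ : ∀ (xs : List A) n {x} → xs !? n ≡ just x → x ∈ xs
!?⇒∈ []       n       eq   = contradiction eq ([]-!?-≢ n)
!?⇒∈ (x ∷ xs) zero    refl = here refl
!?⇒∈ (x ∷ xs) (suc n) eq   = there (!?⇒∈ xs n eq)

∈⇒!? : ∀ {xs : List A} {x} → x ∈ xs → ∃[ n ] xs !? n ≡ just x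
∈⇒!? (here refl) = zero , refl
∈⇒!? (there x∈)  with n , eq ← ∈⇒!? x∈ = suc n , eq

!?⇒< : ∀ (xs : List A) n {x} → xs !? n ≡ just x → n < length xs
!?⇒< []       n       eq = contradiction eq ([]-!?-≢ n)
!?⇒< (x ∷ xs) zero    eq = z<s
!?⇒< (x ∷ xs) (suc n) eq = s<s (!?⇒< xs n eq)

<⇒!? : ∀ (xs : List A) n → n < length xs → ∃[ x ] xs !? n ≡ just x
<⇒!? (x ∷ xs) zero    _       = x , refl
<⇒!? (x ∷ xs) (suc n) (s<s p) = <⇒!? xs n p

!?-ext : ∀ {xs ys : List A} → (∀ n → xs !? n ≡ ys !? n) → xs ≡ ys
!?-ext {xs = []}     {[]}     eq = refl
!?-ext {xs = []}     {y ∷ ys} eq with () ← eq 0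
!?-ext {xs = x ∷ xs} {[]}     eq with () ← eq 0
!?-ext {xs = x ∷ xs} {y ∷ ys} eq = cong₂ _∷_ (just-injective (eq 0)) (!?-ext (eq ∘ suc))

map-!? : ∀ (f : A → B) xs n → map f xs !? n ≡ Maybe.map f (xs !? n)
map-!? f []       zero    = refl
map-!? f []       (suc n) = refl
map-!? f (x ∷ xs) zero    = refl
map-!? f (x ∷ xs) (suc n) = map-!? f xs n

!?⇒All : ∀ {P : A → Set} xs → (∀ n {x} → xs !? n ≡ just x → P x) → All P xs
!?⇒All []       p = []
!?⇒All (x ∷ xs) p = p 0 refl ∷ !?⇒All xs (p ∘ suc)

All⇒!? : ∀ {P : A → Set} {xs} → All P xs → ∀ n {x} → xs !? n ≡ just x → P x
All⇒!? {xs = xs} ps n eq = All.lookup ps (!?⇒∈ xs n eq)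

Linked⇒!? : ∀ {R : Rel A 0ℓ} {xs} → Linked R xs → ∀ n {x y} →
            xs !? n ≡ just x → xs !? suc n ≡ just y → R x y
Linked⇒!? []       n       eq   _    = contradiction eq ([]-!?-≢ n)
Linked⇒!? [-]      zero    _    ()
Linked⇒!? [-]      (suc n) eq   _    = contradiction eq ([]-!?-≢ n)
Linked⇒!? (r ∷ rs) zero    refl refl = r
Linked⇒!? (r ∷ rs) (suc n) eq   eq′  = Linked⇒!? rs n eq eq′

!?⇒Linked : ∀ {R : Rel A 0ℓ} xs →
            (∀ n {x y} → xs !? n ≡ just x → xs !? suc n ≡ just y → R x y) → Linked R xs
!?⇒Linked []           p = []
!?⇒Linked (x ∷ [])     p = [-]
!?⇒Linked (x ∷ y ∷ xs) p = p 0 refl refl ∷ !?⇒Linked (y ∷ xs) (p ∘ suc)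

!?⇒AllPairs : ∀ {R : Rel A 0ℓ} xs →
              (∀ {m n x y} → m < n → xs !? m ≡ just x → xs !? n ≡ just y → R x y) → AllPairs R xs
!?⇒AllPairs []       p = []
!?⇒AllPairs (x ∷ xs) p = !?⇒All xs (λ n → p {0} {suc n} z<s refl) ∷ !?⇒AllPairs xs (p ∘ s<s)

AllPairs⇒!? : ∀ {R : Rel A 0ℓ} {xs} → AllPairs R xs → ∀ {m n x y} → m < n →
              xs !? m ≡ just x → xs !? n ≡ just y → R x y
AllPairs⇒!? []       {m}                    _       eq   _   = contradiction eq ([]-!?-≢ m)
AllPairs⇒!? (r ∷ rs) {zero}  {suc n}        _       refl eq′ = All⇒!? r n eq′
AllPairs⇒!? (r ∷ rs) {suc m} {suc n} (s<s m<n) eq   eq′ = AllPairs⇒!? rs m<n eq eq′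

AllPairs⇒⊎ : ∀ {R : Rel A 0ℓ} {xs x y} → AllPairs R xs → x ∈ xs → y ∈ xs → x ≢ y → R x y ⊎ R y x
AllPairs⇒⊎ (r ∷ rs) (here refl) (here refl) x≢y = contradiction refl x≢y
AllPairs⇒⊎ (r ∷ rs) (here refl) (there y∈)  x≢y = inj₁ (All.lookup r y∈)
AllPairs⇒⊎ (r ∷ rs) (there x∈)  (here refl) x≢y = inj₂ (All.lookup r x∈)
AllPairs⇒⊎ (r ∷ rs) (there x∈)  (there y∈)  x≢y = AllPairs⇒⊎ rs x∈ y∈ x≢y

-- Cells and columns of fillings

cell : Filling → ℕ → ℕ → Maybe ℕ
cell T r c = T !? r >>= λ row → row !? c

cell⁻ : ∀ T r c {x} → T [ r , c ]= x → ∃[ R ] T !? r ≡ just R × R !? c ≡ just x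
cell⁻ T r c eq with T !? r
... | just R = R , refl , eq

cell⁺ : ∀ {T r c x R} → T !? r ≡ just R → R !? c ≡ just x → T [ r , c ]= x
cell⁺ eq eq′ rewrite eq = eq′

∈-column⁺ : ∀ c {x R T} → R ∈ T → R !? c ≡ just x → x ∈ column c T
∈-column⁺ c (here refl) eq rewrite eq = here refl
∈-column⁺ c {T = S ∷ T} (there R∈T) eq with S !? c
... | nothing = ∈-column⁺ c R∈T eq
... | just _  = there (∈-column⁺ c R∈T eq)

∈-column⁻ : ∀ c {x} T → x ∈ column c T → ∃[ R ] R ∈ T × R !? c ≡ just x
∈-column⁻ c (S ∷ T) x∈ with S !? c in eq
∈-column⁻ c (S ∷ T) (here refl) | just _ = S , here refl , eq
∈-column⁻ c (S ∷ T) (there x∈)  | just _ with R , R∈T , eq′ ← ∈-column⁻ c T x∈ = R , there R∈T , eq′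
∈-column⁻ c (S ∷ T) x∈ | nothing with R , R∈T , eq′ ← ∈-column⁻ c T x∈ = R , there R∈T , eq′

column-AllPairs : ∀ {P : Rel ℕ 0ℓ} c T →
                  (∀ {r s x y} → r < s → T [ r , c ]= x → T [ s , c ]= y → P x y) →
                  AllPairs P (column c T)
column-AllPairs c []      p = []
column-AllPairs {P} c (R ∷ T) p with R !? c in eq
... | nothing = column-AllPairs c T (p ∘ s<s)
... | just x  = All.tabulate (λ {y} → later y) ∷ column-AllPairs c T (p ∘ s<s)
  where
  later : ∀ y → y ∈ column c T → P x y
  later y y∈ with S , S∈T , eq′ ← ∈-column⁻ c T y∈ with s , eq″ ← ∈⇒!? S∈T =
    p {0} {suc s} z<s eq (cell⁺ {T} {s} {c} eq″ eq′)

tail-weakComposition : ∀ R T → IsWeakComposition (shape (R ∷ T)) → IsWeakComposition (shape T)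
tail-weakComposition R []      _ ()
tail-weakComposition R (S ∷ T) weak = weak

row-exists : ∀ R T → IsWeakComposition (shape (R ∷ T)) →
             ∃[ r ] ∃[ y ] ∃[ S ] (R ∷ T) !? r ≡ just (y ∷ S)
row-exists []      []      weak = contradiction refl weak
row-exists (y ∷ R) []      weak = 0 , y , R , refl
row-exists R       (S ∷ T) weak with r , y , Q , eq ← row-exists S T weak = suc r , y , Q , eq

-- The hypothesis `same` does not distinguish an empty row from a position above the diagram. As
-- neither filling ends in an empty row, both have the same number of rows, and a row that is not
-- nonempty is `[]` on both sides.
weakComposition-ext : ∀ {X Y} → IsWeakComposition (shape X) → IsWeakComposition (shape Y) →
                      (∀ r {y R} → X !? r ≡ just (y ∷ R) ⇔ Y !? r ≡ just (y ∷ R)) → X ≡ Y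
weakComposition-ext {[]}    {[]}    wX wY same = refl
weakComposition-ext {[]}    {S ∷ Y} wX wY same with r , _ , _ , eq ← row-exists S Y wY =
  contradiction (from (same r) eq) ([]-!?-≢ r)
weakComposition-ext {R ∷ X} {[]}    wX wY same with r , _ , _ , eq ← row-exists R X wX =
  contradiction (to (same r) eq) ([]-!?-≢ r)
weakComposition-ext {R ∷ X} {S ∷ Y} wX wY same =
  cong₂ _∷_ (heads R S (same 0))
            (weakComposition-ext (tail-weakComposition R X wX) (tail-weakComposition S Y wY) (same ∘ suc))
  where
  heads : ∀ (R S : List ℕ) → (∀ {y Q} → just R ≡ just (y ∷ Q) ⇔ just S ≡ just (y ∷ Q)) → R ≡ S
  heads []      []      same = refl
  heads []      (y ∷ S) same = just-injective (from same refl)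
  heads (x ∷ R) S       same = sym (just-injective (to same refl))

-- The list of column sets

col : ℕ → List (List ℕ) → List ℕ
col _       []       = []
col zero    (C ∷ Cs) = C
col (suc c) (C ∷ Cs) = col c Cs

applyUpTo-!?-just : ∀ (f : ℕ → A) {m n} → n < m → applyUpTo f m !? n ≡ just (f n)
applyUpTo-!?-just f {suc m} {zero}  _         = refl
applyUpTo-!?-just f {suc m} {suc n} (s<s n<m) = applyUpTo-!?-just (f ∘ suc) n<m

applyUpTo-!?-nothing : ∀ (f : ℕ → A) {m n} → m ≤ n → applyUpTo f m !? n ≡ nothing
applyUpTo-!?-nothing f {zero}  {n}     _         = []-!? n
applyUpTo-!?-nothing f {suc m} {suc n} (s≤s m≤n) = applyUpTo-!?-nothing (f ∘ suc) m≤n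

column-beyond : ∀ {c} T → All (_≤ c) (shape T) → column c T ≡ []
column-beyond     []      []       = refl
column-beyond {c} (R ∷ T) (p ∷ ps) with R !? c in eq
... | nothing = column-beyond T ps
... | just _  = contradiction (!?⇒< R c eq) (≤⇒≯ p)

columns-!? : ∀ T c → columns T !? c ≡ just (column c T) ⊎ (columns T !? c ≡ nothing × column c T ≡ [])
columns-!? T c with c <? max 0 (shape T)
... | yes c<m = inj₁ (trans (map-!? _ (upTo (max 0 (shape T))) c)
                            (cong (Maybe.map _) (applyUpTo-!?-just id c<m)))
... | no  c≮m = inj₂ (trans (map-!? _ (upTo (max 0 (shape T))) c)
                            (cong (Maybe.map _) (applyUpTo-!?-nothing id m≤c)) ,
                      column-beyond T (All.map (λ l≤m → ≤-trans l≤m m≤c) (xs≤max 0 (shape T))))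
  where m≤c = ≮⇒≥ c≮m

col-!? : ∀ c Cs → col c Cs ≡ Maybe.fromMaybe [] (Cs !? c)
col-!? c       []       rewrite []-!? {A = List ℕ} c = refl
col-!? zero    (C ∷ Cs) = refl
col-!? (suc c) (C ∷ Cs) = col-!? c Cs

col-columns : ∀ c T → col c (columns T) ≡ column c T
col-columns c T rewrite col-!? c (columns T) with columns-!? T c
... | inj₁ eq         rewrite eq = refl
... | inj₂ (eq , eq′) rewrite eq = sym eq′

-- The greedy choice of a row

Least : ℕ → List ℕ → Set
Least x C = x ∈ C × (∀ {z} → z ∈ C → x ≤ z)

min-least : ∀ z zs → Least (min z zs) (z ∷ zs)
min-least z zs = member (argmin-sel id z zs) , lower
  where
  member : min z zs ≡ z ⊎ min z zs ∈ zs → min z zs ∈ z ∷ zs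
  member (inj₁ eq) = here eq
  member (inj₂ m∈) = there m∈
  lower : ∀ {y} → y ∈ z ∷ zs → min z zs ≤ y
  lower (here refl) = min≤⊤ z zs
  lower (there y∈)  = All.lookup (min≤xs z zs) y∈

smallest-least : ∀ {x C} → Least x C → smallest C ≡ just x
smallest-least {x} {z ∷ zs} (x∈ , x≤) with m∈ , m≤ ← min-least z zs =
  cong just (≤-antisym (m≤ x∈) (x≤ m∈))

least-exists : ∀ C → 0 < length C → ∃[ x ] Least x C
least-exists (z ∷ zs) _ = min z zs , min-least z zs

-- R is the row chosen from the columns Cs.  Beyond the end of R, the field
-- lowest says that the columns are empty.
record Greedy (Cs : List (List ℕ)) (R : List ℕ) : Set where
  field
    decreasing : Linked _≥_ R
    member     : ∀ c {x} → R !? c ≡ just x → x ∈ col c Cs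
    lowest     : ∀ c {z} → z ∈ col c Cs → (∀ {y} → R !? suc c ≡ just y → y ≤ z) →
                 ∃[ x ] R !? c ≡ just x × x ≤ z

open Greedy

greedy-[] : ∀ {C Cs} → Greedy (C ∷ Cs) [] → C ≡ [] × Greedy Cs []
greedy-[] {[]}    g = refl , record
  { decreasing = []
  ; member     = λ c eq → contradiction eq ([]-!?-≢ c)
  ; lowest     = λ c z∈ _ → case lowest g (suc c) z∈ (λ ()) of λ ()
  }
greedy-[] {z ∷ C} g with () ← proj₁ (proj₂ (lowest g 0 (here refl) λ ()))

greedy-∷ : ∀ {C Cs x R} → Greedy (C ∷ Cs) (x ∷ R) → Greedy Cs R
greedy-∷ g = record
  { decreasing = Linked.tail (decreasing g)
  ; member     = λ c → member g (suc c)
  ; lowest     = λ c → lowest g (suc c)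
  }

extend-greedy : ∀ {C Cs x} R → Greedy (C ∷ Cs) (x ∷ R) → extend C R ≡ just (x ∷ R)
extend-greedy {C} {x = x} [] g = cong (just ∘ fromMaybe) (smallest-least least)
  where
  least : Least x C
  least = member g 0 refl , λ z∈ → case lowest g 0 z∈ (λ ()) of λ { (_ , refl , x≤z) → x≤z }
extend-greedy {C} {x = x} (y ∷ R) g = cong (Maybe.map (_∷ y ∷ R)) (smallest-least least)
  where
  least : Least x (filter (y ≤?_) C)
  least = ∈-filter⁺ (y ≤?_) (member g 0 refl) (Linked.head (decreasing g)) , lower
    where
    lower : ∀ {z} → z ∈ filter (y ≤?_) C → x ≤ z
    lower z∈ with z∈C , y≤z ← ∈-filter⁻ (y ≤?_) z∈
             with lowest g 0 z∈C (λ { refl → y≤z })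
    ... | _ , refl , le = le

-- Greediness forces every choice from right to left: beyond the end of the row the columns are
-- empty and the choice stays `[]`, and each further entry is the least one that its right neighbour
-- allows.
chooseRow-greedy : ∀ {Cs R} → Greedy Cs R → chooseRow Cs ≡ just R
chooseRow-greedy {[]}     {[]}    g = refl
chooseRow-greedy {[]}     {x ∷ R} g with () ← member g 0 refl
chooseRow-greedy {C ∷ Cs} {[]}    g with refl , g′ ← greedy-[] g
  rewrite chooseRow-greedy g′ = refl
chooseRow-greedy {C ∷ Cs} {x ∷ R} g
  rewrite chooseRow-greedy (greedy-∷ g) = extend-greedy R g

-- Domination of one column set by another

count : ℕ → List ℕ → ℕ
count x C = length (filter (x ≤?_) C)

-- By Hall's theorem, the condition for an injection of the entries of `D` into those of `C` that
-- lowers none of them. In terms of counts it is independent of order and easy to follow through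
-- deletions.
_Dominates_ : List ℕ → List ℕ → Set
C Dominates D = ∀ x → count x D ≤ count x C

infixl 6 _∖_
_∖_ : List ℕ → ℕ → List ℕ
C ∖ y = filter (λ x → ¬? (x ≟ y)) C

module _ {P Q : ℕ → Set} (P? : Decidable P) (Q? : Decidable Q) where

  length-filter-mono : ∀ xs → (∀ {x} → x ∈ xs → P x → Q x) →
                       length (filter P? xs) ≤ length (filter Q? xs)
  length-filter-mono []       p = z≤n
  length-filter-mono (x ∷ xs) p with P? x | Q? x
  ... | yes px | yes qx = s≤s (length-filter-mono xs (p ∘ there))
  ... | yes px | no ¬qx = contradiction (p (here refl) px) ¬qx
  ... | no ¬px | yes qx = m≤n⇒m≤1+n (length-filter-mono xs (p ∘ there))
  ... | no ¬px | no ¬qx = length-filter-mono xs (p ∘ there)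

  filter-comm : ∀ xs → filter P? (filter Q? xs) ≡ filter Q? (filter P? xs)
  filter-comm []       = refl
  filter-comm (x ∷ xs) with P? x in p | Q? x in q
  ... | yes _ | yes _ rewrite p | q = cong (x ∷_) (filter-comm xs)
  ... | yes _ | no _  rewrite q     = filter-comm xs
  ... | no _  | yes _ rewrite p     = filter-comm xs
  ... | no _  | no _                = filter-comm xs

length-filter-unique : ∀ {Q : ℕ → Set} (Q? : Decidable Q) {y xs} → (∀ {x} → y ≢ x → Q x) →
                       Unique xs → length xs ≤ suc (length (filter Q? xs))
length-filter-unique Q? {y} {xs = []}     p []       = z≤n
length-filter-unique Q? {y} {xs = x ∷ xs} p (x∉ ∷ u) with Q? x
... | yes qx = s≤s (length-filter-unique Q? p u)
... | no ¬qx with y ≟ x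
...   | no  y≢x  = contradiction (p y≢x) ¬qx
...   | yes refl = s≤s (≤-reflexive (cong length (sym (filter-all Q? (All.map p x∉)))))

count-mono : ∀ {x y} C → (∀ {z} → z ∈ C → x ≤ z → y ≤ z) → count x C ≤ count y C
count-mono {x} {y} = length-filter-mono (x ≤?_) (y ≤?_)

module _ (x y : ℕ) where

  count-∖ : ∀ C → count x (C ∖ y) ≡ length (filter (x ≤?_) C ∖ y)
  count-∖ C = cong length (filter-comm (x ≤?_) (λ x → ¬? (x ≟ y)) C)

  count-∖-≤ : ∀ C → count x (C ∖ y) ≤ count x C
  count-∖-≤ C rewrite count-∖ C = length-filter _ (filter (x ≤?_) C)

  count-∖-< : ∀ {C} → x ≤ y → y ∈ C → count x (C ∖ y) < count x C
  count-∖-< {C} x≤y y∈ rewrite count-∖ C =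
    filter-notAll _ (filter (x ≤?_) C) (Any.map (λ y≡z ¬eq → ¬eq (sym y≡z)) (∈-filter⁺ (x ≤?_) y∈ x≤y))

  count-∖-≥ : ∀ C → y < x → count x C ≤ count x (C ∖ y)
  count-∖-≥ C y<x rewrite count-∖ C =
    ≤-reflexive (cong length (sym (filter-all _
      (All.map (λ x≤z → >⇒≢ (<-≤-trans y<x x≤z)) (All.all-filter (x ≤?_) C)))))

  count-∖-suc : ∀ {C} → Unique C → count x C ≤ suc (count x (C ∖ y))
  count-∖-suc {C} u rewrite count-∖ C =
    length-filter-unique _ (λ y≢x → y≢x ∘ sym) (Unique.filter⁺ (x ≤?_) u)

-- C has no entry z with w ≤ z < y, so that  count x C  is constant for w ≤ x ≤ y.
dominates-∖ : ∀ {C D y w} → Unique C → C Dominates D → w ∈ D →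
              (∀ {z} → z ∈ C → w ≤ z → y ≤ z) → (C ∖ y) Dominates (D ∖ w)
dominates-∖ {C} {D} {y} {w} u dom w∈ y-lowest x with x ≤? y
... | no  x≰y = begin
  count x (D ∖ w) ≤⟨ count-∖-≤ x w D ⟩
  count x D       ≤⟨ dom x ⟩
  count x C       ≤⟨ count-∖-≥ x y C (≰⇒> x≰y) ⟩
  count x (C ∖ y) ∎ where open ≤-Reasoning
... | yes x≤y with x ≤? w
...   | yes x≤w = s≤s⁻¹ (begin
  suc (count x (D ∖ w)) ≤⟨ count-∖-< x w x≤w w∈ ⟩
  count x D             ≤⟨ dom x ⟩
  count x C             ≤⟨ count-∖-suc x y u ⟩
  suc (count x (C ∖ y)) ∎) where open ≤-Reasoning
-- Here `w < x`, so deleting `w` does not lower the count of `D` at `x`. The threshold is moved down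
-- to `w`, where it does, and on the side of `C` back up to `x`.
...   | no  x≰w = s≤s⁻¹ (begin
  suc (count x (D ∖ w)) ≤⟨ s≤s (count-mono (D ∖ w) (λ _ → ≤-trans (≰⇒≥ x≰w))) ⟩
  suc (count w (D ∖ w)) ≤⟨ count-∖-< w w ≤-refl w∈ ⟩
  count w D             ≤⟨ dom w ⟩
  count w C             ≤⟨ count-mono C (λ z∈ w≤z → ≤-trans x≤y (y-lowest z∈ w≤z)) ⟩
  count x C             ≤⟨ count-∖-suc x y u ⟩
  suc (count x (C ∖ y)) ∎) where open ≤-Reasoning

-- Existence and deletion of the chosen row

-- The choice in `C` cannot fail: the entry `y` chosen in the next column `D` makes the count of `D`
-- at `y` positive, and domination at `y` passes this on to `C`.
greedy-exists : ∀ {Cs} → Linked _Dominates_ Cs → ∃[ R ] Greedy Cs R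
greedy-exists {[]} dom = [] , record
  { decreasing = []
  ; member     = λ c eq → contradiction eq ([]-!?-≢ c)
  ; lowest     = λ c ()
  }
greedy-exists {C ∷ Cs} dom with greedy-exists (Linked.tail dom)
greedy-exists {[] ∷ Cs} dom | [] , g = [] , record
  { decreasing = []
  ; member     = λ c eq → contradiction eq ([]-!?-≢ c)
  ; lowest     = λ where
      zero    ()
      (suc c) z∈ _ → let _ , eq , _ = lowest g c z∈ (λ ()) in contradiction eq ([]-!?-≢ c)
  }
greedy-exists {(z ∷ C) ∷ Cs} dom | [] , g with m∈ , m≤ ← min-least z C = min z C ∷ [] , record
  { decreasing = [-]
  ; member     = λ where
      zero refl → m∈
      (suc c) eq → contradiction eq ([]-!?-≢ c)
  ; lowest     = λ where
      zero z∈ _ → _ , refl , m≤ z∈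
      (suc c) z∈ → lowest g c z∈
  }
greedy-exists {C ∷ []} dom | y ∷ R , g with () ← member g 0 refl
greedy-exists {C ∷ D ∷ Cs} (d ∷ dom) | y ∷ R , g
  with x , x∈ , x≤ ← least-exists (filter (y ≤?_) C)
         (<-≤-trans (filter-some (y ≤?_) {D} (Any.map (λ { refl → ≤-refl }) (member g 0 refl))) (d y))
  with x∈C , y≤x ← ∈-filter⁻ (y ≤?_) x∈ = x ∷ y ∷ R , record
  { decreasing = y≤x ∷ decreasing g
  ; member     = λ where
      zero refl → x∈C
      (suc c) → member g c
  ; lowest     = λ where
      zero z∈ p → _ , refl , x≤ (∈-filter⁺ (y ≤?_) z∈ (p refl))
      (suc c) z∈ → lowest g c z∈
  }

∈-delete⁺ : ∀ R Cs c {z} → z ∈ col c Cs → R !? c ≢ just z → z ∈ col c (delete R Cs)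
∈-delete⁺ []      Cs       c       z∈ ne = z∈
∈-delete⁺ (y ∷ R) (C ∷ Cs) zero    z∈ ne = ∈-filter⁺ (λ x → ¬? (x ≟ y)) z∈ λ { refl → ne refl }
∈-delete⁺ (y ∷ R) (C ∷ Cs) (suc c) z∈ ne = ∈-delete⁺ R Cs c z∈ ne

∈-delete⁻ : ∀ R Cs c {z} → z ∈ col c (delete R Cs) → z ∈ col c Cs × R !? c ≢ just z
∈-delete⁻ []      Cs       c       z∈ = z∈ , []-!?-≢ c
∈-delete⁻ (y ∷ R) (C ∷ Cs) zero    z∈ with z∈C , z≢y ← ∈-filter⁻ (λ x → ¬? (x ≟ y)) {xs = C} z∈ =
  z∈C , λ { refl → z≢y refl }
∈-delete⁻ (y ∷ R) (C ∷ Cs) (suc c) z∈ = ∈-delete⁻ R Cs c z∈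

delete-unique : ∀ R {Cs} → All Unique Cs → All Unique (delete R Cs)
delete-unique []      us       = us
delete-unique (y ∷ R) []       = []
delete-unique (y ∷ R) (u ∷ us) = Unique.filter⁺ (λ x → ¬? (x ≟ y)) u ∷ delete-unique R us

-- For two adjacent columns that both lose an entry, the greedy choice in the left one is what the
-- lemma on deletion from two column sets requires. Where the row ends, the next column is empty and
-- dominated by anything.
delete-dominates : ∀ {Cs R} → Greedy Cs R → All Unique Cs → Linked _Dominates_ Cs →
                   Linked _Dominates_ (delete R Cs)
delete-dominates {[]}         {[]}        g us       dom       = []
delete-dominates {[]}         {x ∷ R}     g us       dom       = []
delete-dominates {C ∷ Cs}     {[]}        g us       dom       = dom
delete-dominates {C ∷ []}     {x ∷ []}    g us       dom       = [-]
delete-dominates {C ∷ D ∷ Cs} {x ∷ []}    g us       (_ ∷ dom)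
  with refl , _ ← greedy-[] (greedy-∷ g) = (λ _ → z≤n) ∷ dom
delete-dominates {C ∷ []}     {x ∷ y ∷ R} g us       dom       with () ← member g 1 refl
delete-dominates {C ∷ D ∷ Cs} {x ∷ y ∷ R} g (u ∷ us) (d ∷ dom) =
  dominates-∖ u d (member g 1 refl) lowest₀ ∷ delete-dominates (greedy-∷ g) us dom
  where
  lowest₀ : ∀ {z} → z ∈ C → y ≤ z → x ≤ z
  lowest₀ z∈ y≤z with lowest g 0 z∈ (λ { refl → y≤z })
  ... | _ , refl , x≤z = x≤z

-- Precedence among rows

-- The condition for R to be chosen while S is still available.  It includes
-- that R is at least as long as S.
Precedes : Rel (List ℕ) 0ℓ
Precedes R S = ∀ c {x} → S !? c ≡ just x → (∀ {y} → R !? suc c ≡ just y → y ≤ x) →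
               ∃[ z ] R !? c ≡ just z × z < x

-- If the entries agreed, the premise of precedence would hold because `R` decreases, and the common
-- entry would be smaller than itself.
precedes-distinct : ∀ {R S} → Linked _≥_ R → Precedes R S → ∀ c {x} →
                    R !? c ≡ just x → S !? c ≢ just x
precedes-distinct dec prec c eq eq′ with prec c eq′ (Linked⇒!? dec c eq)
... | _ , eq″ , z<x = <⇒≢ z<x (just-injective (trans (sym eq″) eq))

-- In column `length R` the premise of precedence is vacuous, so an entry of `S` there would require
-- one of `R`.
precedes-length : ∀ {R S} → Precedes R S → length S ≤ length R
precedes-length {R} {S} prec with length S ≤? length R
... | yes le = le
... | no ¬le with x , eq ← <⇒!? S (length R) (≰⇒> ¬le)
             with _ , eq′ , _ ← prec (length R) eq
                    (λ e → contradiction (!?⇒< R (suc (length R)) e) (<-asym (n<1+n (length R)))) =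
  contradiction (!?⇒< R (length R) eq′) (<-irrefl refl)

-- Induction to the left: if `z < x` in column `suc c`, the entry of `S` in column `c` is at least
-- `x`, hence at least the next entry of `R`, which is the premise of precedence in column `c`.
precedes-heads : ∀ {R S} → Precedes R S → Linked _≥_ S → ∀ c {z x} →
                 R !? c ≡ just z → S !? c ≡ just x → z < x →
                 ∃[ a ] ∃[ b ] R !? 0 ≡ just a × S !? 0 ≡ just b × a < b
precedes-heads         prec dec zero    eq eq′ z<x = _ , _ , eq , eq′ , z<x
precedes-heads {R} {S} prec dec (suc c) eq eq′ z<x
  with x′ , eq″ ← <⇒!? S c (<-trans (n<1+n c) (!?⇒< S (suc c) eq′))
  with z′ , eq‴ , z′<x′ ← prec c eq″ (λ e → subst (_≤ x′) (just-injective (trans (sym eq) e))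
                                              (≤-trans (<⇒≤ z<x) (Linked⇒!? dec c eq″ eq′))) =
  precedes-heads prec dec c eq‴ eq″ z′<x′

-- The rows L, in the order of their choice, exhaust the columns Cs.
record Rows (Cs : List (List ℕ)) (L : List (List ℕ)) : Set where
  field
    nonempty   : All (λ R → 0 < length R) L
    decreasing : All (Linked _≥_) L
    precedence : AllPairs Precedes L
    cells      : ∀ c {z} → z ∈ col c Cs ⇔ z ∈ column c L

open Rows

-- An entry still present in a column belongs to `R` or to a later row, and for later rows
-- precedence gives `lowest`.
rows⇒greedy : ∀ {Cs R L} → Rows Cs (R ∷ L) → Greedy Cs R
rows⇒greedy {Cs} {R} {L} rows = record
  { decreasing = All.head (decreasing rows)
  ; member     = λ c eq → from (cells rows c) (∈-column⁺ c {T = R ∷ L} (here refl) eq)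
  ; lowest     = λ c z∈ p → low c p (∈-column⁻ c (R ∷ L) (to (cells rows c) z∈))
  }
  where
  low : ∀ c {z} → (∀ {y} → R !? suc c ≡ just y → y ≤ z) →
        ∃[ S ] S ∈ R ∷ L × S !? c ≡ just z → ∃[ x ] R !? c ≡ just x × x ≤ z
  low c p (S , here refl , eq) = _ , eq , ≤-refl
  low c p (S , there S∈  , eq) =
    let x , eq′ , x<z = All.lookup (AllPairs.head (precedence rows)) S∈ c eq p in x , eq′ , <⇒≤ x<z

rows⇒greedy-[] : ∀ {Cs} → Rows Cs [] → Greedy Cs []
rows⇒greedy-[] rows = record
  { decreasing = []
  ; member     = λ c eq → contradiction eq ([]-!?-≢ c)
  ; lowest     = λ c z∈ _ → contradiction (to (cells rows c) z∈) λ ()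
  }

-- Column sets forget the rows of their entries. Deleting `R` still takes nothing from later rows,
-- since precedence makes the entries in each column differ.
rows-delete : ∀ {Cs R L} → Rows Cs (R ∷ L) → Rows (delete R Cs) L
rows-delete {Cs} {R} {L} rows = record
  { nonempty   = All.tail (nonempty rows)
  ; decreasing = All.tail (decreasing rows)
  ; precedence = AllPairs.tail (precedence rows)
  ; cells      = λ c → mk⇔ (into c) (out c)
  }
  where
  into : ∀ c {z} → z ∈ col c (delete R Cs) → z ∈ column c L
  into c z∈ with z∈C , ne ← ∈-delete⁻ R Cs c z∈
    with ∈-column⁻ c (R ∷ L) (to (cells rows c) z∈C)
  ... | _ , here refl , eq = contradiction eq ne
  ... | _ , there S∈  , eq = ∈-column⁺ c S∈ eq
  out : ∀ c {z} → z ∈ column c L → z ∈ col c (delete R Cs)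
  out c z∈ with S , S∈ , eq ← ∈-column⁻ c L z∈ =
    ∈-delete⁺ R Cs c (from (cells rows c) (∈-column⁺ c {T = R ∷ L} (there S∈) eq))
      (λ eq′ → precedes-distinct (All.head (decreasing rows))
                 (All.lookup (AllPairs.head (precedence rows)) S∈) c eq′ eq)

-- Entries left after the deletion were available when `R` was chosen. Under the premise of
-- precedence, greediness makes the entry of `R` at most theirs, and the deletion rules out
-- equality.
rows-∷ : ∀ {Cs R L} → Greedy Cs R → 0 < length R → Rows (delete R Cs) L → Rows Cs (R ∷ L)
rows-∷ {Cs} {R} {L} g ne rows = record
  { nonempty   = ne ∷ nonempty rows
  ; decreasing = decreasing g ∷ decreasing rows
  ; precedence = All.tabulate prec ∷ precedence rows
  ; cells      = λ c → mk⇔ (into c) (out c)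
  }
  where
  left : ∀ c {S x} → S ∈ L → S !? c ≡ just x → x ∈ col c Cs × R !? c ≢ just x
  left c S∈ eq = ∈-delete⁻ R Cs c (from (cells rows c) (∈-column⁺ c S∈ eq))
  prec : ∀ {S} → S ∈ L → Precedes R S
  prec S∈ c eq p with x∈ , ne ← left c S∈ eq with z , eq′ , z≤x ← lowest g c x∈ p =
    z , eq′ , ≤∧≢⇒< z≤x λ { refl → ne eq′ }
  into : ∀ c {z} → z ∈ col c Cs → z ∈ column c (R ∷ L)
  into c {z} z∈ with ≡-dec _≟_ (R !? c) (just z)
  ... | yes eq = ∈-column⁺ c {T = R ∷ L} (here refl) eq
  ... | no  ne with S , S∈ , eq ← ∈-column⁻ c L (to (cells rows c) (∈-delete⁺ R Cs c z∈ ne)) =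
    ∈-column⁺ c (there S∈) eq
  out : ∀ c {z} → z ∈ column c (R ∷ L) → z ∈ col c Cs
  out c z∈ with ∈-column⁻ c (R ∷ L) z∈
  ... | _ , here refl , eq = member g c eq
  ... | _ , there S∈  , eq = proj₁ (left c S∈ eq)

-- Every nonempty row starts in the first column, so the size of that column is the termination
-- measure and bounds the number of rounds.
delete-shrinks : ∀ {Cs x R} → Greedy Cs (x ∷ R) → length (col 0 (delete (x ∷ R) Cs)) < length (col 0 Cs)
delete-shrinks {[]}     g with () ← member g 0 refl
delete-shrinks {C ∷ Cs} g = filter-notAll _ C (Any.map (λ x≡z ¬eq → ¬eq (sym x≡z)) (member g 0 refl))

rows-exist : ∀ n {Cs} → length (col 0 Cs) < n → All Unique Cs → Linked _Dominates_ Cs → ∃[ L ] Rows Cs L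
rows-exist (suc n) {Cs} (s≤s len) uniq dom with greedy-exists dom
... | [] , g = [] , record
  { nonempty   = []
  ; decreasing = []
  ; precedence = []
  ; cells      = λ c → mk⇔
      (λ z∈ → let _ , eq , _ = lowest g c z∈ (λ ()) in contradiction eq ([]-!?-≢ c))
      λ ()
  }
... | R@(_ ∷ _) , g with L , rows ← rows-exist n (<-≤-trans (delete-shrinks g) len)
                                     (delete-unique R uniq) (delete-dominates g uniq dom) =
  R ∷ L , rows-∷ g z<s rows

-- The rounds of the algorithm

Vacant : Filling → ℕ → Set
Vacant T r = ∀ {x xs} → T !? r ≢ just (x ∷ xs)

-- `rows` describes only nonempty rows, because `place` may insert empty ones below position `i`.
record Placed (i : ℕ) (R : List ℕ) (T T′ : Filling) : Set where
  field
    rows : ∀ r {x xs} → T′ !? r ≡ just (x ∷ xs) ⇔ (T !? r ≡ just (x ∷ xs) ⊎ (r ≡ i × x ∷ xs ≡ R))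
    top  : IsWeakComposition (shape T) → IsWeakComposition (shape T′)

-- The result has the form `S ∷ T′` so that `last` skips any row put in front of it, which lets
-- `top` pass through the recursion.
place-vacant : ∀ i y ys T → Vacant T i →
               ∃[ S ] ∃[ T′ ] place (suc i) (y ∷ ys) T ≡ just (S ∷ T′) × Placed i (y ∷ ys) T (S ∷ T′)
place-vacant zero y ys [] vac = _ , _ , refl , record
  { rows = λ r → mk⇔ (λ eq → inj₂ (first r eq)) λ where
      (inj₁ eq) → contradiction eq ([]-!?-≢ r)
      (inj₂ (refl , refl)) → refl
  ; top  = λ _ ()
  }
  where
  first : ∀ r {x xs} → ((y ∷ ys) ∷ []) !? r ≡ just (x ∷ xs) → r ≡ 0 × x ∷ xs ≡ y ∷ ys
  first zero    refl = refl , refl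
  first (suc r) eq   = contradiction eq ([]-!?-≢ r)
place-vacant zero y ys ([] ∷ T) vac = _ , _ , refl , record
  { rows = λ where
      zero    → mk⇔ (λ { refl → inj₂ (refl , refl) }) λ { (inj₁ ()) ; (inj₂ (_ , refl)) → refl }
      (suc r) → mk⇔ inj₁ λ { (inj₁ eq) → eq ; (inj₂ ()) }
  ; top  = top T
  }
  where
  top : ∀ T → IsWeakComposition (shape ([] ∷ T)) → IsWeakComposition (shape ((y ∷ ys) ∷ T))
  top []      _ ()
  top (S ∷ T) p = p
place-vacant zero y ys ((_ ∷ _) ∷ T) vac = contradiction refl vac
place-vacant (suc i) y ys [] vac
  with S , T′ , eq , placed ← place-vacant i y ys [] ([]-!?-≢ i) =
  [] , S ∷ T′ , cong (Maybe.map ([] ∷_)) eq , record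
  { rows = λ where
      zero    → mk⇔ (λ ()) λ { (inj₁ ()) ; (inj₂ ()) }
      (suc r) → mk⇔
        (λ eq → case to (Placed.rows placed r) eq of λ where
          (inj₁ eq)           → contradiction eq ([]-!?-≢ r)
          (inj₂ (refl , eq′)) → inj₂ (refl , eq′))
        λ { (inj₁ ()) ; (inj₂ (refl , eq)) → from (Placed.rows placed r) (inj₂ (refl , eq)) }
  ; top  = λ p → Placed.top placed p
  }
place-vacant (suc i) y ys (R ∷ T) vac
  with S , T′ , eq , placed ← place-vacant i y ys T vac =
  R , S ∷ T′ , cong (Maybe.map (R ∷_)) eq , record
  { rows = λ where
      zero    → mk⇔ inj₁ λ { (inj₁ eq) → eq ; (inj₂ ()) }
      (suc r) → mk⇔
        (λ eq → case to (Placed.rows placed r) eq of λ where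
          (inj₁ eq)           → inj₁ eq
          (inj₂ (refl , eq′)) → inj₂ (refl , eq′))
        λ { (inj₁ eq) → from (Placed.rows placed r) (inj₁ eq)
          ; (inj₂ (refl , eq)) → from (Placed.rows placed r) (inj₂ (refl , eq)) }
  ; top  = λ p → Placed.top placed (tail-weakComposition R T p)
  }

record Filled (L : List (List ℕ)) (T T′ : Filling) : Set where
  field
    rows : ∀ r {x xs} → T′ !? r ≡ just (x ∷ xs) ⇔ (T !? r ≡ just (x ∷ xs) ⊎ (x ∷ xs ∈ L × x ≡ suc r))
    top  : IsWeakComposition (shape T) → IsWeakComposition (shape T′)

-- The invariant that keeps `place` from failing is the last hypothesis: the first entries of the
-- rows still to come name vacant positions.
fillRows-rows : ∀ n {Cs L} T → Rows Cs L → length (col 0 Cs) < n →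
                (∀ {x xs} → x ∷ xs ∈ L → ∃[ r ] x ≡ suc r × Vacant T r) →
                ∃[ T′ ] fillRows n Cs T ≡ just T′ × Filled L T T′
fillRows-rows (suc n) {Cs} {[]} T rs len vac rewrite chooseRow-greedy (rows⇒greedy-[] rs) =
  T , refl , record { rows = λ _ → mk⇔ inj₁ λ { (inj₁ eq) → eq ; (inj₂ (() , _)) } ; top = id }
fillRows-rows (suc n) {Cs} {[] ∷ L} T rs len vac with () ← All.head (nonempty rs)
fillRows-rows (suc n) {Cs} {(y ∷ ys) ∷ L} T rs (s≤s len) vac
  with i , refl , vacᵢ ← vac (here refl)
  with S , T₁ , eq , placed ← place-vacant i (suc i) ys T vacᵢ
  with T′ , eq′ , filled ← fillRows-rows n (S ∷ T₁) (rows-delete rs)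
         (<-≤-trans (delete-shrinks (rows⇒greedy rs)) len)
         -- The position just taken belongs to no later row, since precedence makes the first
         -- entries differ.
         (λ {x} {xs} S∈ → let r , x≡ , vacᵣ = vac (there S∈) in r , x≡ , λ e →
            case to (Placed.rows placed r) e of λ where
              (inj₁ e)          → vacᵣ e
              (inj₂ (r≡i , _)) → precedes-distinct (All.head (decreasing rs))
                (All.lookup (AllPairs.head (precedence rs)) S∈) 0 refl (cong just (trans x≡ (cong suc r≡i))))
  rewrite chooseRow-greedy (rows⇒greedy rs) | eq =
  T′ , eq′ , record
    { rows = λ r → mk⇔
        (λ e → case to (Filled.rows filled r) e of λ where
          (inj₂ (S∈ , e)) → inj₂ (there S∈ , e)
          (inj₁ e)        → case to (Placed.rows placed r) e of λ where
            (inj₁ e)             → inj₁ e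
            (inj₂ (refl , refl)) → inj₂ (here refl , refl))
        λ where
          (inj₁ e)                  →
            from (Filled.rows filled r) (inj₁ (from (Placed.rows placed r) (inj₁ e)))
          (inj₂ (here refl , refl)) →
            from (Filled.rows filled r) (inj₁ (from (Placed.rows placed r) (inj₂ (refl , refl))))
          (inj₂ (there S∈ , e))     → from (Filled.rows filled r) (inj₂ (S∈ , e))
    ; top  = Filled.top filled ∘ Placed.top placed
    }

!?-tail : ∀ {A : Set} (xs : List A) n {x} → xs !? suc n ≡ just x → ∃[ y ] xs !? n ≡ just y
!?-tail xs n eq = <⇒!? xs n (<-trans (n<1+n n) (!?⇒< xs (suc n) eq))

decreasing-≤-head : ∀ {R a} → Linked _≥_ R → R !? 0 ≡ just a → ∀ c {x} → R !? c ≡ just x → x ≤ a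
decreasing-≤-head     dec eq zero    eq′ = ≤-reflexive (just-injective (trans (sym eq′) eq))
decreasing-≤-head {R} dec eq (suc c) eq′ =
  AllPairs⇒!? (Linked.Linked⇒AllPairs (flip ≤-trans) dec) z<s eq eq′

-- What `Filled` says when the initial filling is empty. It determines `T`, so a filling can be
-- identified with the output without following the rounds.
record Assembles (L : List (List ℕ)) (T : Filling) : Set where
  field
    rows : ∀ r {x xs} → T !? r ≡ just (x ∷ xs) ⇔ (x ∷ xs ∈ L × x ≡ suc r)
    top  : IsWeakComposition (shape T)

assembles-unique : ∀ {L T T′} → Assembles L T → Assembles L T′ → T ≡ T′
assembles-unique a a′ = weakComposition-ext (Assembles.top a) (Assembles.top a′)
  λ r → mk⇔ (from (Assembles.rows a′ r) ∘ to (Assembles.rows a r))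
            (from (Assembles.rows a r) ∘ to (Assembles.rows a′ r))

length-column-0 : ∀ T → length (column 0 T) ≤ sum (shape T)
length-column-0 []            = z≤n
length-column-0 ([] ∷ T)      = length-column-0 T
length-column-0 ((x ∷ R) ∷ T) = s≤s (≤-trans (length-column-0 T) (m≤n+m _ (length R)))

ψ-assembles : ∀ V {L} → Rows (columns V) L → (∀ {z} → z ∈ column 0 V → 0 < z) →
              ∃[ T ] ψ V ≡ just T × Assembles L T
ψ-assembles V {L} rs pos = result (fillRows-rows (suc (sum (shape V))) [] rs
    (s≤s (subst (λ C → length C ≤ sum (shape V)) (sym (col-columns 0 V)) (length-column-0 V))) vacant)
  where
  vacant : ∀ {x xs} → x ∷ xs ∈ L → ∃[ r ] x ≡ suc r × Vacant [] r
  vacant {x} R∈ = pred x , sym (suc-pred x ⦃ >-nonZero (pos x∈) ⦄) , []-!?-≢ (pred x)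
    where x∈ = subst (x ∈_) (col-columns 0 V) (from (cells rs 0) (∈-column⁺ 0 R∈ refl))
  result : ∃[ T ] ψ V ≡ just T × Filled L [] T → ∃[ T ] ψ V ≡ just T × Assembles L T
  result (T , eq , filled) = T , eq , record
    { rows = λ r → mk⇔
        (λ e → [ (λ e → contradiction e ([]-!?-≢ r)) , id ]′ (to (Filled.rows filled r) e))
        (from (Filled.rows filled r) ∘ inj₂)
    ; top  = Filled.top filled λ ()
    }

-- Quasi-key tableaux

module _ {Cs L T} (rs : Rows Cs L) (assembles : Assembles L T)
         (pos : ∀ c {z} → z ∈ col c Cs → 0 < z) where

  private
    row∈ : ∀ r c {R x} → T !? r ≡ just R → R !? c ≡ just x → R ∈ L × R !? 0 ≡ just (suc r)
    row∈ r c {[]}    eq eq′ = contradiction eq′ ([]-!?-≢ c)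
    row∈ r c {y ∷ R} eq eq′ with R∈ , refl ← to (Assembles.rows assembles r) eq = R∈ , refl

    dec : ∀ {R} → R ∈ L → Linked _≥_ R
    dec = All.lookup (decreasing rs)

    All-rows : ∀ {P : List ℕ → Set} → P [] → (∀ {R} → R ∈ L → P R) → All P T
    All-rows {P} p[] p = !?⇒All T λ r {R} → go r R
      where
      go : ∀ r R → T !? r ≡ just R → P R
      go r []      _  = p[]
      go r (y ∷ R) eq = p (proj₁ (to (Assembles.rows assembles r) eq))

    comparable : ∀ {r s R S} → R ∈ L × R !? 0 ≡ just (suc r) → S ∈ L × S !? 0 ≡ just (suc s) →
                 r ≢ s → Precedes R S ⊎ Precedes S R
    comparable (R∈ , eq) (S∈ , eq′) r≢s =
      AllPairs⇒⊎ (precedence rs) R∈ S∈ λ { refl → r≢s (suc-injective (just-injective (trans (sym eq) eq′))) }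

    -- Otherwise `precedes-heads` would give the higher row `S` the smaller first entry, but the
    -- first entries are the row indices.
    not-below : ∀ {r s R S} → r < s → R ∈ L × R !? 0 ≡ just (suc r) → S ∈ L × S !? 0 ≡ just (suc s) →
                Precedes S R → ∀ c {x y} → R !? c ≡ just x → S !? c ≡ just y → ¬ y < x
    not-below r<s (R∈ , eq) (S∈ , eq′) prec c eqx eqy y<x
      with _ , _ , e , e′ , lt ← precedes-heads prec (dec R∈) c eqy eqx y<x
      with refl ← trans (sym eq) e′ | refl ← trans (sym eq′) e = <-asym r<s (s<s⁻¹ lt)

  assembled-cells : ∀ c {z} → z ∈ col c Cs ⇔ z ∈ column c T
  assembled-cells c {z} = mk⇔ into out
    where
    into : z ∈ col c Cs → z ∈ column c T
    into z∈ with ∈-column⁻ c L (to (cells rs c) z∈)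
    ... | []    , R∈ , eq = contradiction eq ([]-!?-≢ c)
    ... | x ∷ R , R∈ , eq =
      ∈-column⁺ c (!?⇒∈ T (pred x) (from (Assembles.rows assembles (pred x)) (R∈ , x≡))) eq
      where
      x≡ : x ≡ suc (pred x)
      x≡ = sym (suc-pred x ⦃ >-nonZero (pos 0 (from (cells rs 0) (∈-column⁺ 0 R∈ refl))) ⦄)
    out : z ∈ column c T → z ∈ col c Cs
    out z∈ with R , R∈ , eq ← ∈-column⁻ c T z∈ with r , eq′ ← ∈⇒!? R∈ =
      from (cells rs c) (∈-column⁺ c {T = L} (proj₁ (row∈ r c eq′ eq)) eq)

  assembled-firstColumn : ∀ {r x} → T [ r , 0 ]= x → x ≡ suc r
  assembled-firstColumn {r} eq with R , eq′ , eq″ ← cell⁻ T r 0 eq =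
    just-injective (trans (sym eq″) (proj₂ (row∈ r 0 eq′ eq″)))

  assembled-quasiKey : IsQuasiKey (shape T) T
  assembled-quasiKey = record
    { hasShape       = refl
    ; positive       = All-rows [] λ {R} R∈ → !?⇒All R λ c eq →
        pos c (from (cells rs c) (∈-column⁺ c {T = L} R∈ eq))
    ; rowsDecrease   = All-rows [] dec
    ; rowBound       = λ {r} {c} → bound {r} {c}
    ; columnDistinct = λ {r} {s} {c} → distinct {r} {s} {c}
    ; firstIncreases = increases
    ; inversion      = inv
    ; longerAbove    = longer
    }
    where
    bound : ∀ {r c x} → T [ r , c ]= x → x ≤ suc r
    bound {r} {c} eq with R , eq′ , eq″ ← cell⁻ T r c eq with R∈ , eq₀ ← row∈ r c eq′ eq″ =
      decreasing-≤-head (dec R∈) eq₀ c eq″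

    distinct : ∀ {r s c x y} → r ≢ s → T [ r , c ]= x → T [ s , c ]= y → x ≢ y
    distinct {r} {s} {c} r≢s x∈ y∈ refl
      with R , eqR , eqx ← cell⁻ T r c x∈ | S , eqS , eqy ← cell⁻ T s c y∈
      with R∈ ← row∈ r c eqR eqx | S∈ ← row∈ s c eqS eqy
      with comparable R∈ S∈ r≢s
    ... | inj₁ prec = precedes-distinct (dec (proj₁ R∈)) prec c eqx eqy
    ... | inj₂ prec = precedes-distinct (dec (proj₁ S∈)) prec c eqy eqx

    increases : ∀ {r s x y} → r < s → T [ r , 0 ]= x → T [ s , 0 ]= y → x < y
    increases {r} {s} r<s eqx eqy
      rewrite assembled-firstColumn {r} eqx | assembled-firstColumn {s} eqy = s<s r<s

    -- If `S` precedes `R`, then `not-below` excludes `i < k`. If `R` precedes `S`, the entry of `R`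
    -- to the right of `k` must exist and exceed `i`, as precedence would otherwise give `k < i`.
    inv : ∀ {r s c i k} → r < s → T [ s , c ]= i → T [ r , c ]= k → i < k →
          ∃[ j ] T [ r , suc c ]= j × i < j
    inv {r} {s} {c} {i} {k} r<s i∈ k∈ i<k
      with R , eqR , eqk ← cell⁻ T r c k∈ | S , eqS , eqi ← cell⁻ T s c i∈
      with R∈ ← row∈ r c eqR eqk | S∈ ← row∈ s c eqS eqi
      with comparable R∈ S∈ (<⇒≢ r<s)
    ... | inj₂ prec = contradiction i<k (not-below r<s R∈ S∈ prec c eqk eqi)
    ... | inj₁ prec = found (R !? suc c) refl
      where
      too-small : ¬ (∀ {y} → R !? suc c ≡ just y → y ≤ i)
      too-small p with _ , eq , lt ← prec c eqi p with refl ← trans (sym eq) eqk = <-asym i<k lt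
      found : ∀ m → R !? suc c ≡ m → ∃[ j ] T [ r , suc c ]= j × i < j
      found nothing  eq = ⊥-elim (too-small λ e → contradiction (trans (sym eq) e) λ ())
      found (just j) eq with i <? j
      ... | yes i<j = j , cell⁺ {T} {r} {suc c} eqR eq , i<j
      ... | no  i≮j = ⊥-elim (too-small λ e → subst (_≤ i) (just-injective (trans (sym eq) e)) (≮⇒≥ i≮j))

    -- The shorter row cannot precede the longer one, so `S` precedes `R`. If `j ≤ i`, this would
    -- put an entry of `S` smaller than `i` into column `c`, against `not-below`.
    longer : ∀ {r s R S c i j} → r < s → T !? r ≡ just R → T !? s ≡ just S → length R < length S →
             T [ r , c ]= i → T [ s , suc c ]= j → i < j
    longer {r} {s} {R} {S} {c} {i} {j} r<s eqR eqS lt i∈ j∈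
      with _ , eqR′ , eqi ← cell⁻ T r c i∈ | _ , eqS′ , eqj ← cell⁻ T s (suc c) j∈
      with refl ← trans (sym eqR) eqR′ | refl ← trans (sym eqS) eqS′
      with R∈ ← row∈ r c eqR eqi | S∈ ← row∈ s (suc c) eqS eqj
      with comparable R∈ S∈ (<⇒≢ r<s)
    ... | inj₁ prec = contradiction lt (≤⇒≯ (precedes-length prec))
    ... | inj₂ prec with i <? j
    ...   | yes i<j = i<j
    ...   | no  i≮j
      with _ , eqz , z<i ← prec c eqi (λ e → subst (_≤ i) (just-injective (trans (sym eqj) e)) (≮⇒≥ i≮j)) =
      contradiction z<i (not-below r<s R∈ S∈ prec c eqi eqz)

-- Recovering the order of choice from a quasi-key tableau

module _ {a T} (qk : IsQuasiKey a T) (first : ∀ {r x} → T [ r , 0 ]= x → x ≡ suc r) where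
  open IsQuasiKey qk

  -- The lengths provide an entry of `R`, and as column entries are distinct, it only has to be
  -- shown not to exceed `x`. If `R` is the lower row, `inversion` would put an entry larger than
  -- `x` to its right, against `p`. If `R` is the higher row, it is strictly longer, and
  -- `longerAbove` does the same.
  quasiKey-precedes : ∀ r s {R S} → T !? r ≡ just R → T !? s ≡ just S →
                      length S < length R ⊎ (length S ≡ length R × r < s) → Precedes R S
  quasiKey-precedes r s {R} {S} eqR eqS longer c {x} eqx p = smaller (<⇒!? R c (<-≤-trans c<S S≤R))
    where
    c<S : c < length S
    c<S = !?⇒< S c eqx
    S≤R : length S ≤ length R
    S≤R = [ <⇒≤ , ≤-reflexive ∘ proj₁ ]′ longer
    r≢s : r ≢ s
    r≢s refl with refl ← trans (sym eqR) eqS = [ <-irrefl refl , <-irrefl refl ∘ proj₂ ]′ longer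
    x∈ : T [ s , c ]= x
    x∈ = cell⁺ {T} {s} {c} eqS eqx
    not-larger : ∀ {z} → R !? c ≡ just z → ¬ x < z
    not-larger eqz x<z with <-cmp r s
    ... | tri≈ _ r≡s _ = r≢s r≡s
    ... | tri< r<s _ _ with j , j∈ , x<j ← inversion {c = c} r<s x∈ (cell⁺ {T} {r} {c} eqR eqz) x<z
                       with R′ , eqR′ , eqj ← cell⁻ T r (suc c) j∈
                       with refl ← trans (sym eqR) eqR′ = <⇒≱ x<j (p eqj)
    ... | tri> _ _ s<r = case longer of λ where
      (inj₂ (_ , r<s)) → <-asym r<s s<r
      (inj₁ S<R)       → let y , eqy = <⇒!? R (suc c) (≤-<-trans c<S S<R) in
        <⇒≱ (longerAbove {c = c} s<r eqS eqR S<R x∈ (cell⁺ {T} {r} {suc c} eqR eqy)) (p eqy)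
    smaller : ∃[ z ] R !? c ≡ just z → ∃[ z ] R !? c ≡ just z × z < x
    smaller (z , eqz) = z , eqz ,
      ≤∧≢⇒< (≮⇒≥ (not-larger eqz)) (columnDistinct {c = c} r≢s (cell⁺ {T} {r} {c} eqR eqz) x∈)

  private
    -- The shift to `suc k` leaves out the empty rows, which the algorithm never produces. Filtering
    -- keeps the order from bottom to top.
    bucket : ℕ → List (List ℕ)
    bucket k = filter (λ R → length R ≟ suc k) T

    lengths : List ℕ
    lengths = downFrom (max 0 (shape T))

    buckets : List (List (List ℕ))
    buckets = map bucket lengths

  -- The order in which the row-filling algorithm recovers the rows of T:
  -- longer rows first, and lower rows first among those of equal length.
  byLength : List (List ℕ)
  byLength = concat buckets

  private
    ∈-byLength⁻ : ∀ {R} → R ∈ byLength → R ∈ T × 0 < length R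
    ∈-byLength⁻ R∈ with _ , R∈b , b∈ ← ∈-concat⁻′ buckets R∈
      with k , _ , refl ← ∈-map⁻ bucket b∈
      with R∈T , eq ← ∈-filter⁻ (λ R → length R ≟ suc k) {xs = T} R∈b = R∈T , subst (0 <_) (sym eq) z<s

    ∈-byLength⁺ : ∀ {x R} → x ∷ R ∈ T → x ∷ R ∈ byLength
    ∈-byLength⁺ R∈ = ∈-concat⁺′ (∈-filter⁺ (λ R → length R ≟ _) R∈ refl)
      (∈-map⁺ bucket (∈-downFrom⁺ (All.lookup (All.map⁻ (xs≤max 0 (shape T))) R∈)))

    T-pairs : AllPairs (λ R S → length S ≡ length R → Precedes R S) T
    T-pairs = !?⇒AllPairs T λ {r} {s} r<s eqR eqS len → quasiKey-precedes r s eqR eqS (inj₂ (len , r<s))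

    within : ∀ k → AllPairs Precedes (bucket k)
    within k = go (AllPairs.filter⁺ (λ R → length R ≟ suc k) T-pairs)
                  (All.all-filter (λ R → length R ≟ suc k) T)
      where
      go : ∀ {L} → AllPairs (λ R S → length S ≡ length R → Precedes R S) L →
           All (λ R → length R ≡ suc k) L → AllPairs Precedes L
      go []       []       = []
      go (p ∷ ps) (l ∷ ls) = All.zipWith (λ (f , l′) → f (trans l′ (sym l))) (p , ls) ∷ go ps ls

    between : ∀ {k l} → k < l → All (λ R → All (Precedes R) (bucket k)) (bucket l)
    between {k} {l} k<l = All.tabulate λ R∈ → All.tabulate λ S∈ →
      prec (∈-filter⁻ (λ R → length R ≟ suc l) R∈) (∈-filter⁻ (λ R → length R ≟ suc k) S∈)
      where
      prec : ∀ {R S} → R ∈ T × length R ≡ suc l → S ∈ T × length S ≡ suc k → Precedes R S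
      prec (R∈ , eqR) (S∈ , eqS) with r , eqr ← ∈⇒!? R∈ with s , eqs ← ∈⇒!? S∈ =
        quasiKey-precedes r s eqr eqs (inj₁ (subst₂ _<_ (sym eqS) (sym eqR) (s<s k<l)))

  -- Rows in one bucket are compared by position and rows in different buckets by length, the two
  -- alternatives of `quasiKey-precedes`.
  byLength-rows : ∀ {Cs} → (∀ c {z} → z ∈ col c Cs ⇔ z ∈ column c T) → Rows Cs byLength
  byLength-rows {Cs} same = record
    { nonempty   = All.tabulate (proj₂ ∘ ∈-byLength⁻)
    ; decreasing = All.tabulate (All.lookup rowsDecrease ∘ proj₁ ∘ ∈-byLength⁻)
    ; precedence = AllPairs.concat⁺ {xss = buckets} (All.map⁺ (All.universal within lengths))
                     (AllPairs.map⁺ {xs = lengths}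
                       (AllPairs.applyDownFrom⁺₁ id (max 0 (shape T)) λ k<l _ → between k<l))
    ; cells      = λ c → mk⇔ (into c ∘ to (same c)) (from (same c) ∘ out c)
    }
    where
    into : ∀ c {z} → z ∈ column c T → z ∈ column c byLength
    into c z∈ with ∈-column⁻ c T z∈
    ... | []    , _  , eq = contradiction eq ([]-!?-≢ c)
    ... | _ ∷ _ , R∈ , eq = ∈-column⁺ c (∈-byLength⁺ R∈) eq
    out : ∀ c {z} → z ∈ column c byLength → z ∈ column c T
    out c z∈ with R , R∈ , eq ← ∈-column⁻ c byLength z∈ = ∈-column⁺ c {T = T} (proj₁ (∈-byLength⁻ R∈)) eq

  byLength-assembles : IsWeakComposition a → Assembles byLength T
  byLength-assembles weak = record
    { rows = λ r → mk⇔
        (λ eq → ∈-byLength⁺ (!?⇒∈ T r eq) , first {r} (cell⁺ {T} {r} {0} eq refl))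
        λ (R∈ , eq) → at r eq (∈⇒!? (proj₁ (∈-byLength⁻ R∈)))
    ; top  = subst (λ p → last p ≢ just 0) (sym hasShape) weak
    }
    where
    at : ∀ r {x R} → x ≡ suc r → ∃[ s ] T !? s ≡ just (x ∷ R) → T !? r ≡ just (x ∷ R)
    at r eq (s , eq′) with refl ← trans (sym eq) (first {s} (cell⁺ {T} {s} {0} eq′ refl)) = eq′

-- Counting in sorted columns

length-filter-∷ : ∀ {P : ℕ → Set} (P? : Decidable P) x xs →
                  length (filter P? (x ∷ xs)) ≤ suc (length (filter P? xs))
length-filter-∷ P? x xs with P? x
... | yes _ = ≤-refl
... | no  _ = n≤1+n _

count-> : ∀ {xs r x} → AllPairs _≥_ xs → xs !? r ≡ just x → r < count x xs
count-> {[]}     {r}            []       eq = contradiction eq ([]-!?-≢ r)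
count-> {y ∷ xs} {zero}  {x}    (p ∷ ps) refl rewrite filter-accept (x ≤?_) {x} {xs} ≤-refl = z<s
count-> {y ∷ xs} {suc r} {x}    (p ∷ ps) eq
  rewrite filter-accept (x ≤?_) {y} {xs} (All⇒!? p r eq) = s<s (count-> ps eq)

count-≤ : ∀ {xs r x y} → AllPairs _≥_ xs → xs !? r ≡ just x → x < y → count y xs ≤ r
count-≤ {[]}     {r}           []       eq   x<y = contradiction eq ([]-!?-≢ r)
count-≤ {x ∷ xs} {zero}  {y = y} (p ∷ ps) refl x<y =
  ≤-reflexive (cong length (filter-none (y ≤?_) (<⇒≱ x<y ∷ All.map (λ z≤x → <⇒≱ (≤-<-trans z≤x x<y)) p)))
count-≤ {z ∷ xs} {suc r} {y = y} (p ∷ ps) eq   x<y =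
  ≤-trans (length-filter-∷ (y ≤?_) z xs) (s≤s (count-≤ ps eq x<y))

-- If `x < y`, then `D` would have more than `r` entries that are at least `y`, and `C` at most `r`.
dominates-!? : ∀ {C D} → AllPairs _≥_ C → AllPairs _≥_ D → C Dominates D →
               ∀ r {x y} → C !? r ≡ just x → D !? r ≡ just y → y ≤ x
dominates-!? decC decD dom r {x} {y} eqx eqy =
  ≮⇒≥ λ x<y → <⇒≱ (count-> {r = r} decD eqy) (≤-trans (dom y) (count-≤ {r = r} decC eqx x<y))

>-sorted-unique : ∀ {xs ys} → AllPairs _>_ xs → AllPairs _>_ ys → (∀ {z} → z ∈ xs ⇔ z ∈ ys) → xs ≡ ys
>-sorted-unique {[]}     {[]}     _ _ _ = refl
>-sorted-unique {[]}     {y ∷ ys} _ _ same with () ← from same (here refl)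
>-sorted-unique {x ∷ xs} {[]}     _ _ same with () ← to same (here refl)
>-sorted-unique {x ∷ xs} {y ∷ ys} (p ∷ ps) (q ∷ qs) same = cong₂ _∷_ x≡y (>-sorted-unique ps qs (mk⇔
  (λ z∈ → Any.tail (λ z≡y → <⇒≢ (All.lookup p z∈) (trans z≡y (sym x≡y))) (to same (there z∈)))
  (λ z∈ → Any.tail (λ z≡x → <⇒≢ (All.lookup q z∈) (trans z≡x x≡y)) (from same (there z∈)))))
  where
  heads : x ∈ y ∷ ys → y ∈ x ∷ xs → x ≡ y
  heads (here eq)  _          = eq
  heads (there x∈) (here eq)  = sym eq
  heads (there x∈) (there y∈) = contradiction (All.lookup p y∈) (<-asym (All.lookup q x∈))
  x≡y : x ≡ y
  x≡y = heads (to same (here refl)) (from same (here refl))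

-- Row by row: an entry in column `suc c` has a left neighbour that is at least as large and so
-- inherits the upward closed `P`.
length-filter-column : ∀ {P : ℕ → Set} (P? : Decidable P) → (∀ {x y} → x ≤ y → P x → P y) →
  ∀ {T} → All (Linked _≥_) T → ∀ c →
  length (filter P? (column (suc c) T)) ≤ length (filter P? (column c T))
length-filter-column P? up []                c = z≤n
length-filter-column P? up {R ∷ T} (d ∷ dec) c with R !? suc c in eq′
... | nothing with R !? c
...   | nothing = length-filter-column P? up dec c
...   | just x with P? x
...     | yes _ = m≤n⇒m≤1+n (length-filter-column P? up dec c)
...     | no  _ = length-filter-column P? up dec c
length-filter-column P? up {R ∷ T} (d ∷ dec) c | just y with R !? c in eq
... | nothing with () ← trans (sym eq) (proj₂ (!?-tail R c eq′))
... | just x with P? y | P? x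
...   | yes _  | yes _  = s≤s (length-filter-column P? up dec c)
...   | yes py | no ¬px = contradiction (up (Linked⇒!? d c eq eq′) py) ¬px
...   | no _   | yes _  = m≤n⇒m≤1+n (length-filter-column P? up dec c)
...   | no _   | no _   = length-filter-column P? up dec c

column-dominates : ∀ {T} → All (Linked _≥_) T → ∀ c → column c T Dominates column (suc c) T
column-dominates dec c x = length-filter-column (x ≤?_) (flip ≤-trans) dec c

-- The tableau φ(T)

Linked-map-upTo : ∀ {A : Set} {R : Rel A 0ℓ} (f : ℕ → A) → (∀ i → R (f i) (f (suc i))) →
                  ∀ n → Linked R (map f (upTo n))
Linked-map-upTo f r n = Linked.map⁺ (Linked.applyUpTo⁺₂ id n r)

-- In general `column` skips the rows that are too short, which shifts later entries. With
-- decreasing row lengths the skipped rows all come last.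
column-cell : ∀ {X} → Linked _≥_ (shape X) → ∀ c r → column c X !? r ≡ cell X r c
column-cell {X} dec c = go X (Linked.Linked⇒AllPairs (flip ≤-trans) dec)
  where
  empty : ∀ X → All (_≤ c) (shape X) → ∀ r → nothing ≡ cell X r c
  empty X short r with X !? r in eq
  ... | nothing = refl
  ... | just R with R !? c in eq′
  ...   | nothing = refl
  ...   | just _  = contradiction (!?⇒< R c eq′) (≤⇒≯ (All⇒!? (All.map⁻ short) r eq))
  go : ∀ X → AllPairs _≥_ (shape X) → ∀ r → column c X !? r ≡ cell X r c
  go []      _        r rewrite []-!? {A = List ℕ} r = []-!? r
  go (R ∷ X) (p ∷ ps) r with R !? c in eq
  go (R ∷ X) (p ∷ ps) zero    | just x = sym eq
  go (R ∷ X) (p ∷ ps) (suc r) | just x = go X ps r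
  go (R ∷ X) (p ∷ ps) r       | nothing =
    trans (cong (_!? r) (column-beyond X short)) (trans ([]-!? r) (empty (R ∷ X) (R≤c ∷ short) r))
    where
    R≤c : length R ≤ c
    R≤c = ≮⇒≥ λ c<R → case trans (sym eq) (proj₂ (<⇒!? R c c<R)) of λ ()
    short : All (_≤ c) (shape X)
    short = All.map (λ S≤R → ≤-trans S≤R R≤c) p

cell-columns : ∀ X r c → cell (columns X) r c ≡ column r X !? c
cell-columns X r c with columns-!? X r
... | inj₁ eq         rewrite eq = refl
... | inj₂ (eq , eq′) rewrite eq | eq′ = sym ([]-!? c)

length-column-suc : ∀ X c → length (column (suc c) X) ≤ length (column c X)
length-column-suc []      c = z≤n
length-column-suc (R ∷ X) c with R !? suc c in eq′
... | nothing with R !? c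
...   | nothing = length-column-suc X c
...   | just _  = m≤n⇒m≤1+n (length-column-suc X c)
length-column-suc (R ∷ X) c | just y with R !? c in eq
... | nothing with () ← trans (sym eq) (proj₂ (!?-tail R c eq′))
... | just _  = s≤s (length-column-suc X c)

-- True of any filling: column lengths decrease because rows are left-justified, and no listed
-- column is empty because a longest row meets all of them.
shape-columns : ∀ X → IsPartition (shape (columns X))
shape-columns X = All.map⁺ (All.map⁺ (All.applyUpTo⁺₁ id _ column-length)) ,
  Linked.map⁺ (Linked-map-upTo (λ c → column c X) (length-column-suc X) _)
  where
  column-length : ∀ {c} → c < max 0 (shape X) → 0 < length (column c X)
  column-length {c} c<m with column c X in eq
  ... | _ ∷ _ = z<s
  ... | []    = contradiction (max≤v⁺ z≤n (All.map⁺ (All.tabulate λ {R} R∈ → ≮⇒≥ (short R∈)))) (<⇒≱ c<m)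
    where
    short : ∀ {R} → R ∈ X → ¬ c < length R
    short {R} R∈ c<R with x , eqx ← <⇒!? R c c<R with () ← subst (x ∈_) eq (∈-column⁺ c R∈ eqx)

partition-ext : ∀ {X Y} → IsPartition (shape X) → IsPartition (shape Y) →
                (∀ c → column c X ≡ column c Y) → X ≡ Y
partition-ext {X} {Y} (posX , decX) (posY , decY) eq = go (All.map⁻ posX) (All.map⁻ posY) λ r c →
  trans (sym (column-cell decX c r)) (trans (cong (_!? r) (eq c)) (column-cell decY c r))
  where
  go : ∀ {X Y} → All (λ R → 0 < length R) X → All (λ R → 0 < length R) Y →
       (∀ r c → cell X r c ≡ cell Y r c) → X ≡ Y
  go []                []                eq = refl
  go []                (_∷_ {_ ∷ _} _ _) eq with () ← eq 0 0
  go (_∷_ {_ ∷ _} _ _) []                eq with () ← eq 0 0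
  go (_ ∷ ps)          (_ ∷ qs)          eq = cong₂ _∷_ (!?-ext (eq 0)) (go ps qs (eq ∘ suc))

sortDecreasing-↭ : ∀ C → sortDecreasing C ↭ C
sortDecreasing-↭ = sort-↭ (Flip.decTotalOrder ≤-decTotalOrder)

∈-sortDecreasing : ∀ C {z} → z ∈ C ⇔ z ∈ sortDecreasing C
∈-sortDecreasing C = mk⇔ (∈-resp-↭ (↭-sym (sortDecreasing-↭ C))) (∈-resp-↭ (sortDecreasing-↭ C))

sortDecreasing-≥ : ∀ C → AllPairs _≥_ (sortDecreasing C)
sortDecreasing-≥ C = Linked.Linked⇒AllPairs (flip ≤-trans) (sort-↗ (Flip.decTotalOrder ≤-decTotalOrder) C)

sortDecreasing-> : ∀ {C} → Unique C → AllPairs _>_ (sortDecreasing C)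
sortDecreasing-> {C} u = AllPairs.map (λ (x≢y , y≤x) → ≤∧≢⇒< y≤x (x≢y ∘ sym))
  (AllPairs.zip (↭ₛ.Unique-resp-↭ (setoid ℕ) (↭⇒↭ₛ (↭-sym (sortDecreasing-↭ C))) u , sortDecreasing-≥ C))

sortDecreasing-[] : sortDecreasing [] ≡ []
sortDecreasing-[] = ↭-empty-inv (sortDecreasing-↭ [])

count-sort : ∀ x C → count x (sortDecreasing C) ≡ count x C
count-sort x C = ↭-length (filter-↭ (x ≤?_) (sortDecreasing-↭ C))

φ-cell : ∀ T r c → cell (φ T) r c ≡ sortDecreasing (column c T) !? r
φ-cell T r c = begin
  cell (φ T) r c                      ≡⟨ cell-columns S r c ⟩
  column r S !? c                     ≡⟨ column-cell decS r c ⟩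
  cell S c r                          ≡⟨ sorted ⟩
  sortDecreasing (column c T) !? r    ∎
  where
  open ≡-Reasoning
  S = map sortDecreasing (columns T)
  -- Sorting keeps lengths, so the sorted columns, read as rows, still have decreasing lengths, as
  -- `column-cell` requires.
  decS : Linked _≥_ (shape S)
  decS = subst (Linked _≥_)
    (trans (map-cong (λ C → sym (↭-length (sortDecreasing-↭ C))) (columns T)) (map-∘ (columns T)))
    (proj₂ (shape-columns T))
  sorted : cell S c r ≡ sortDecreasing (column c T) !? r
  sorted rewrite map-!? sortDecreasing (columns T) c with columns-!? T c
  ... | inj₁ eq         rewrite eq = refl
  ... | inj₂ (eq , eq′) rewrite eq | eq′ | sortDecreasing-[] = sym ([]-!? r)

column-φ : ∀ c T → column c (φ T) ≡ sortDecreasing (column c T)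
column-φ c T = !?-ext λ r →
  trans (column-cell (proj₂ (shape-columns (map sortDecreasing (columns T)))) c r) (φ-cell T r c)

column-unique⇒columns : ∀ T → (∀ c → Unique (column c T)) → All Unique (columns T)
column-unique⇒columns T u = All.map⁺ (All.universal u _)

columns-dominate : ∀ {T} → All (Linked _≥_) T → Linked _Dominates_ (columns T)
columns-dominate dec = Linked-map-upTo _ (column-dominates dec) _

column-positive : ∀ {T} → All (All (0 <_)) T → ∀ c {z} → z ∈ column c T → 0 < z
column-positive {T} pos c z∈ with R , R∈ , eq ← ∈-column⁻ c T z∈ = All⇒!? (All.lookup pos R∈) c eq

-- The two maps on tableaux

module _ {p V} (rev : IsRevSSYT p V) where
  open IsRevSSYT rev

  revSSYT-column-> : ∀ c → AllPairs _>_ (column c V)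
  revSSYT-column-> c = column-AllPairs c V (columnsDecrease {c = c})

  -- The conditions on `V` are what `rows-exist` needs: strictly decreasing columns have no
  -- repetitions, and weakly decreasing rows make each column dominate the next. The list of rows so
  -- obtained describes the output of `ψ`.
  ψ-quasiKey : ∃[ T ] ψ V ≡ just T × IsWeakComposition (shape T) × IsQuasiKey (shape T) T ×
               (∀ {r x} → T [ r , 0 ]= x → x ≡ suc r) × (∀ c {z} → z ∈ column c V ⇔ z ∈ column c T)
  ψ-quasiKey = result (rows-exist _ ≤-refl
      (column-unique⇒columns V λ c → AllPairs.map >⇒≢ (revSSYT-column-> c)) (columns-dominate rowsDecrease))
    where
    pos : ∀ c {z} → z ∈ col c (columns V) → 0 < z
    pos c {z} z∈ = column-positive positive c (subst (z ∈_) (col-columns c V) z∈)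
    result : ∃[ L ] Rows (columns V) L → _
    result (L , rs) with T , eq , as ← ψ-assembles V rs (column-positive positive 0) =
      T , eq , Assembles.top as , assembled-quasiKey rs as pos ,
      (λ {r} {x} → assembled-firstColumn rs as pos {r} {x}) ,
      λ c {z} → subst (λ C → z ∈ C ⇔ z ∈ column c T) (col-columns c V) (assembled-cells rs as pos c)

module _ {a T} (qk : IsQuasiKey a T) where
  open IsQuasiKey qk

  quasiKey-unique : ∀ c → Unique (column c T)
  quasiKey-unique c = column-AllPairs c T λ r<s → columnDistinct {c = c} (<⇒≢ r<s)

  φ-revSSYT : IsRevSSYT (shape (φ T)) (φ T)
  φ-revSSYT = record
    { hasShape        = refl
    ; positive        = !?⇒All (φ T) λ r {R} eqR → !?⇒All R λ c eq → column-positive positive c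
        (from (∈-sortDecreasing (column c T)) (!?⇒∈ _ r (entry r c (cell⁺ {φ T} {r} {c} eqR eq))))
    -- Sorting changes no counts, so each sorted column still dominates the next, and for sorted
    -- columns this means comparison in each row.
    ; rowsDecrease    = !?⇒All (φ T) λ r {R} eqR → !?⇒Linked R λ c eqx eqy →
        dominates-!? (sortDecreasing-≥ (column c T)) (sortDecreasing-≥ (column (suc c) T))
          (λ x → subst₂ _≤_ (sym (count-sort x (column (suc c) T))) (sym (count-sort x (column c T)))
                   (column-dominates rowsDecrease c x))
          r (entry r c (cell⁺ {φ T} {r} {c} eqR eqx)) (entry r (suc c) (cell⁺ {φ T} {r} {suc c} eqR eqy))
    ; columnsDecrease = λ {r} {s} {c} r<s x∈ y∈ →
        AllPairs⇒!? (sortDecreasing-> (quasiKey-unique c)) r<s (entry r c x∈) (entry s c y∈)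
    }
    where
    entry : ∀ r c {x} → φ T [ r , c ]= x → sortDecreasing (column c T) !? r ≡ just x
    entry r c = trans (sym (φ-cell T r c))

  column-set-φ : ∀ c {z} → z ∈ column c T ⇔ z ∈ column c (φ T)
  column-set-φ c {z} =
    subst (λ C → z ∈ column c T ⇔ z ∈ C) (sym (column-φ c T)) (∈-sortDecreasing (column c T))

  -- The algorithm sees `V` only through its column sets, which the rows in `byLength` exhaust. Its
  -- output and `T` are therefore both assembled from these rows, and such a filling is unique.
  ψ-column-sets : IsWeakComposition a → (∀ {r x} → T [ r , 0 ]= x → x ≡ suc r) →
                  ∀ V → (∀ c {z} → z ∈ column c T ⇔ z ∈ column c V) → ψ V ≡ just T
  ψ-column-sets weak first V same =
    let T′ , eq , as = ψ-assembles V (byLength-rows qk first exhausted)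
                         (column-positive positive 0 ∘ from (same 0))
    in trans eq (cong just (assembles-unique as (byLength-assembles qk first weak)))
    where
    exhausted : ∀ c {z} → z ∈ col c (columns V) ⇔ z ∈ column c T
    exhausted c {z} = subst (λ C → z ∈ C ⇔ z ∈ column c T) (sym (col-columns c V))
      (mk⇔ (from (same c)) (to (same c)))

-- Column by column, both sides are strictly decreasing lists with the same elements, and a tableau
-- of partition shape is determined by its columns.
φ-ψ : ∀ {a p V T} → IsQuasiKey a T → IsPartition p → IsRevSSYT p V →
      (∀ c {z} → z ∈ column c V ⇔ z ∈ column c T) → φ T ≡ V
φ-ψ {V = V} {T = T} qk part rev same = partition-ext (shape-columns (map sortDecreasing (columns T)))
  (subst IsPartition (sym (IsRevSSYT.hasShape rev)) part) λ c → trans (column-φ c T)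
    (>-sorted-unique (sortDecreasing-> (quasiKey-unique qk c)) (revSSYT-column-> rev c)
      (mk⇔ (from (same c) ∘ from (∈-sortDecreasing (column c T)))
           (to (∈-sortDecreasing (column c T)) ∘ to (same c))))

-- The bijection

ψ-result : ∀ V → ∃[ T ] ψ (tableau V) ≡ just (filling T) ×
           (∀ c {z} → z ∈ column c (tableau V) ⇔ z ∈ column c (filling T))
ψ-result V =
  let _ , _ , rev = RevSSYT.partition V
      T , eq , weak , qk , first , same = ψ-quasiKey rev
  in record { filling = T ; quasiKey = _ , weak , qk ; firstColumn = λ {r} {x} → first {r} {x} } , eq , same

fromQKT¹ : QKT¹ → RevSSYT
fromQKT¹ T = record
  { tableau   = φ (filling T)
  ; partition = shape (φ (filling T)) , shape-columns (map sortDecreasing (columns (filling T))) ,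
                φ-revSSYT (proj₂ (proj₂ (quasiKey T)))
  }

theorem5p8 : Σ (Inverse revSSYT qKT¹) λ bij →
    (∀ V → ψ (tableau V) ≡ just (filling (Inverse.to bij V)))
    × (∀ T → tableau (Inverse.from bij T) ≡ φ (filling T))
    × (∀ V c → column c (tableau V) ∼[ set ] column c (filling (Inverse.to bij V)))
    × (∀ T c → column c (filling T) ∼[ set ] column c (tableau (Inverse.from bij T)))
theorem5p8 = bijection , to-ψ , (λ _ → refl) , (λ V c → proj₂ (proj₂ (ψ-result V)) c) ,
             λ T c → column-set-φ (proj₂ (proj₂ (quasiKey T))) c
  where
  to-ψ : ∀ V → ψ (tableau V) ≡ just (filling (proj₁ (ψ-result V)))
  to-ψ V = proj₁ (proj₂ (ψ-result V))
  bijection : Inverse revSSYT qKT¹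
  bijection = record
    { to        = proj₁ ∘ ψ-result
    ; from      = fromQKT¹
    -- The image is constructed from the proofs about `V` as well, but its filling is the value of
    -- `ψ`, which depends on the tableau alone.
    ; to-cong   = λ {V} {W} V≈W → just-injective (trans (sym (to-ψ V)) (trans (cong ψ V≈W) (to-ψ W)))
    ; from-cong = cong φ
    ; inverse   =
        (λ {T} {V} V≈φT →
          let _ , weak , qk = quasiKey T
              ψφ≡ = ψ-column-sets qk weak (λ {r} {x} → firstColumn T {r} {x}) (φ (filling T)) (column-set-φ qk)
          in just-injective (trans (sym (to-ψ V)) (trans (cong ψ V≈φT) ψφ≡))) ,
        (λ {V} {T} T≈ψV →
          let U , _ , same = ψ-result V
              _ , _ , qk = quasiKey U
              _ , part , rev = RevSSYT.partition V
          in trans (cong φ T≈ψV) (φ-ψ qk part rev same))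
    }
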